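{- If $D$ is a digraph with $n$ vertices, then $D$ has a subtree representation in a star with at most $n$ leaves.
   Context: A digraph $D$ is finite with nonempty vertex set $V(D)$; loops are allowed, no multiple edges. A star with $m$ leaves is the tree $K_{1,m}$, consisting of a center adjacent to $m$ other vertices (its leaves; the center is not counted as a leaf). Subtrees are nonempty connected subgraphs. A subtree representation of $D$ in a host tree $T$ assigns to each vertex $v$ an ordered pair $(S_v,T_v)$ of subtrees of $T$ such that $uv$ is an edge of $D$ if and only if $S_u$ and $T_v$ have a common vertex (for all $u,v\in V(D)$, including $u=v$). -}

module Defs where

open import Data.Sum using (_⊎_; inj₁; inj₂)
open import Data.Fin using (Fin; zero; suc; inject₁; fromℕ)
open import Data.Fin.Subset using (Subset; _∈_; Nonempty)
open import Data.Nat using (ℕ; suc; NonZero)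
open import Data.Product using (_×_; ∃-syntax)
open import Function.Bundles using (_⇔_)
open import Function using (case_of_)
open import Function.Definitions using (Injective)
open import Level using (0ℓ)
open import Relation.Binary.Construct.Closure.ReflexiveTransitive using (Star; ε; _◅_)
open import Relation.Binary.Core using (Rel)
open import Relation.Binary.Definitions using (Decidable; Symmetric; Irreflexive)
open import Relation.Binary.PropositionalEquality using (_≡_; refl)
open import Relation.Nullary using (¬_; yes; no)

record Digraph (n : ℕ) : Set₁ where
  field
    .{{nonempty}} : NonZero n
    _⟶_  : Rel (Fin n) 0ℓ
    _⟶?_ : Decidable _⟶_

record Graph (n : ℕ) : Set₁ where
  field
    Adj        : Rel (Fin n) 0ℓ
    adj?       : Decidable Adj
    adj-sym    : Symmetric Adj
    adj-irrefl : Irreflexive _≡_ Adj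

record Cycle {n : ℕ} (G : Graph n) : Set where
  open Graph G
  field
    {k}      : ℕ
    c        : Fin (suc (suc (suc k))) → Fin n
    distinct : Injective _≡_ _≡_ c
    step     : ∀ i → Adj (c (inject₁ i)) (c (suc i))
    close    : Adj (c (fromℕ (suc (suc k)))) (c zero)

record Tree (n : ℕ) : Set₁ where
  field
    graph        : Graph n
    .{{nonempty}} : NonZero n
    connected    : ∀ x y → Star (Graph.Adj graph) x y
    acyclic      : ¬ Cycle graph

record Subgraph {n : ℕ} (G : Graph n) : Set₁ where
  field
    vertices : Subset n
    Edge     : Rel (Fin n) 0ℓ
    edge?    : Decidable Edge
    edge-sym : Symmetric Edge
    edge⇒adj : ∀ {x y} → Edge x y → Graph.Adj G x y
    edge⇒∈   : ∀ {x y} → Edge x y → x ∈ vertices × y ∈ vertices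

record Subtree {n : ℕ} (T : Tree n) : Set₁ where
  field
    subgraph : Subgraph (Tree.graph T)
  open Subgraph subgraph public
  field
    nonempty  : Nonempty vertices
    -- Walks along Edge stay inside vertices by edge⇒∈.
    connected : ∀ {x y} → x ∈ vertices → y ∈ vertices → Star Edge x y

record SubtreeRepresentation {n t : ℕ} (D : Digraph n) (H : Tree t) : Set₁ where
  open Digraph D using (_⟶_)
  field
    S T : Fin n → Subtree H
    represents : ∀ u v →
      u ⟶ v ⇔ (∃[ x ] x ∈ Subtree.vertices (S u) × x ∈ Subtree.vertices (T v))

-- K_{1,m}: the centre is zero, the m leaves are suc i.

data StarAdj {m : ℕ} : Rel (Fin (suc m)) 0ℓ where
  centre-leaf : ∀ i → StarAdj zero (suc i)
  leaf-centre : ∀ i → StarAdj (suc i) zero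

starGraph : ∀ m → Graph (suc m)
starGraph m = record
  { Adj        = StarAdj
  ; adj?       = adj?
  ; adj-sym    = λ { (centre-leaf i) → leaf-centre i ; (leaf-centre i) → centre-leaf i }
  ; adj-irrefl = λ { refl () }
  }
  where
  adj? : Decidable (StarAdj {m})
  adj? zero    zero    = no λ ()
  adj? zero    (suc i) = yes (centre-leaf i)
  adj? (suc i) zero    = yes (leaf-centre i)
  adj? (suc i) (suc j) = no λ ()

starTree : ∀ m → Tree (suc m)
starTree m = record
  { graph     = starGraph m
  ; connected = connected
  ; acyclic   = acyclic
  }
  where
  connected : ∀ x y → Star (StarAdj {m}) x y
  connected zero    zero    = ε
  connected zero    (suc j) = centre-leaf j ◅ ε
  connected (suc i) zero    = leaf-centre i ◅ ε
  connected (suc i) (suc j) = leaf-centre i ◅ centre-leaf j ◅ ε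

  neighbours : ∀ {a b x y : Fin (suc m)} → StarAdj a b → StarAdj b x → StarAdj y a →
               a ≡ x ⊎ y ≡ b
  neighbours (centre-leaf _) (leaf-centre _) _ = inj₁ refl
  neighbours (leaf-centre _) _ (centre-leaf _) = inj₂ refl

  acyclic : ¬ Cycle (starGraph m)
  acyclic C with neighbours (step zero) (step (suc zero)) close
    where open Cycle C
  ... | inj₁ eq = case Cycle.distinct C eq of λ ()
  ... | inj₂ eq = case Cycle.distinct C eq of λ ()

{-# OPTIONS --safe #-}

-- Let T v be the single leaf v, and let S u consist of the centre together with
-- the leaves v such that u ⟶ v.
module Submission where

open import Data.Bool using (true)
open import Data.Fin using (Fin; zero; suc)
open import Data.Fin.Subset using (Subset; inside; _∈_; ⁅_⁆)
open import Data.Fin.Subset.Properties using (_∈?_; x∈⁅x⁆; x∈⁅y⁆⇒x≡y; drop-there)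
open import Data.Nat using (ℕ; _≤_)
open import Data.Nat.Properties using (≤-refl)
open import Data.Product using (_×_; ∃-syntax; _,_; proj₂)
open import Data.Vec using (_∷_; tabulate; here; there)
open import Data.Vec.Properties using (lookup⇒[]=; []=⇒lookup; lookup∘tabulate)
open import Function.Bundles using (mk⇔)
open import Level using (0ℓ)
open import Relation.Binary.Construct.Closure.ReflexiveTransitive using (Star; ε; _◅_)
open import Relation.Binary.PropositionalEquality using (_≡_; refl; sym; trans)
open import Relation.Nullary using (Dec; yes; does; _×-dec_)
open import Relation.Nullary.Decidable using (dec-true)
open import Relation.Unary using (Pred; Decidable)
open import Defs

-- In a star, any set of leaves becomes a subtree once the centre is added, so every
-- out-neighbourhood can be encoded as some `S u`. Each `T v` avoids the centre, so the centre
-- shared by all the `S u` creates no spurious intersection: `S u` meets `T v` exactly when leaf `v`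
-- was put into `S u`. One leaf per vertex suffices.

module _ {n : ℕ} {P : Pred (Fin n) 0ℓ} (P? : Decidable P) where

  comprehension : Subset n
  comprehension = tabulate λ x → does (P? x)

  ∈-comprehension⁺ : ∀ {x} → P x → x ∈ comprehension
  ∈-comprehension⁺ {x} px =
    lookup⇒[]= x _ (trans (lookup∘tabulate _ x) (dec-true (P? x) px))

  ∈-comprehension⁻ : ∀ {x} → x ∈ comprehension → P x
  ∈-comprehension⁻ {x} x∈ =
    witness (P? x) (trans (sym (lookup∘tabulate _ x)) ([]=⇒lookup x∈))
    where
    -- Stated for an arbitrary `Dec`, so that matching computes `does`; a negative answer would give
    -- `false ≡ true`.
    witness : ∀ {A : Set} (a? : Dec A) → does a? ≡ true → A
    witness (yes a) refl = a

-- Each edge carries the membership of both its ends, so walks cannot leave `p`.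
induced : ∀ {n} (G : Graph n) → Subset n → Subgraph G
induced G p = record
  { vertices = p
  ; Edge     = λ x y → Adj x y × x ∈ p × y ∈ p
  ; edge?    = λ x y → adj? x y ×-dec (x ∈? p) ×-dec (y ∈? p)
  ; edge-sym = λ (xy , x∈p , y∈p) → adj-sym xy , y∈p , x∈p
  ; edge⇒adj = λ (xy , _) → xy
  ; edge⇒∈   = proj₂
  }
  where open Graph G

singleton : ∀ {n} (T : Tree n) → Fin n → Subtree T
singleton T x = record
  { subgraph  = G
  ; nonempty  = x , x∈⁅x⁆ x
  ; connected = connected
  }
  where
  G = induced (Tree.graph T) ⁅ x ⁆
  connected : ∀ {y z} → y ∈ ⁅ x ⁆ → z ∈ ⁅ x ⁆ → Star (Subgraph.Edge G) y z
  connected y∈ z∈ with refl ← x∈⁅y⁆⇒x≡y x y∈ | refl ← x∈⁅y⁆⇒x≡y x z∈ = ε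

-- The head `inside` is the centre. It gives nonemptiness even when `p` is empty, and joins any two
-- leaves by a walk of length two.
centreWith : ∀ {m} → Subset m → Subtree (starTree m)
centreWith {m} p = record
  { subgraph  = G
  ; nonempty  = zero , here
  ; connected = connected
  }
  where
  G = induced (starGraph m) (inside ∷ p)
  connected : ∀ {x y} → x ∈ inside ∷ p → y ∈ inside ∷ p → Star (Subgraph.Edge G) x y
  connected {zero}  {zero}  _  _  = ε
  connected {zero}  {suc j} x∈ y∈ = (centre-leaf j , x∈ , y∈) ◅ ε
  connected {suc i} {zero}  x∈ y∈ = (leaf-centre i , x∈ , y∈) ◅ ε
  connected {suc i} {suc j} x∈ y∈ =
    (leaf-centre i , x∈ , here) ◅ (centre-leaf j , here , y∈) ◅ ε

theorem1 : (n : ℕ) (D : Digraph n) →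
    ∃[ m ] m ≤ n × SubtreeRepresentation D (starTree m)
theorem1 n D = n , ≤-refl , record
  { S = λ u → centreWith (comprehension (u ⟶?_))
  ; T = λ v → singleton (starTree n) (suc v)
  ; represents = λ u v → mk⇔
      (λ u⟶v → suc v , there (∈-comprehension⁺ (u ⟶?_) u⟶v) , x∈⁅x⁆ (suc v))
      (meet⇒edge u v)
  }
  where
  open Digraph D
  meet⇒edge : ∀ u v → ∃[ x ] x ∈ inside ∷ comprehension (u ⟶?_) × x ∈ ⁅ suc v ⁆ → u ⟶ v
  -- The common vertex can only be the leaf `suc v`; dropping the centre from `S u` leaves `v` among
  -- the out-neighbours of `u`.
  meet⇒edge u v (x , x∈S , x∈T) with refl ← x∈⁅y⁆⇒x≡y (suc v) x∈T =
    ∈-comprehension⁻ (u ⟶?_) (drop-there x∈S)
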